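{- Let $t$ be a nonnegative integer and let $p_1=1$, $p_2=4$, $p_3=8$, $p_4=18$, $p_5=31$, $\mu_1=1$, $\mu_2=5$, $\mu_3=14$, $\mu_4=20$, $\mu_5=9298+13236132t$, $a_1=4671576t+3282$, $a_2=472719t+332$, $a_3=143871t+101$, $a_4=31372t+22$, $a_5=159936t+112$, and $n=\sum_{i=1}^5 a_ip_i=13236132t+9286$. (These are integers related by $p_1-2<\mu_1<p_2-2<\mu_2<p_3-2<\mu_3<p_4-2<\mu_4<p_5-2<\mu_5$ and $a_k=\frac{\prod_{i=1}^{5}(\mu_i-p_k+2)}{p_k\prod_{i=1,i\ne k}^{5}(p_i-p_k)}$ for $k=1,\dots,5$.) Then for every positive integer $q$, the complete multipartite graph $K_{a_1\cdot p_1q,\,a_2\cdot p_2q,\,a_3\cdot p_3q,\,a_4\cdot p_4q,\,a_5\cdot p_5q}$ on $qn$ vertices is distance integral.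
   Context: For a simple connected undirected graph $G$ with vertices $v_1,\dots,v_N$, the distance matrix $D(G)$ is the $N\times N$ matrix whose $(i,j)$-entry is the length $d_{ij}$ of a shortest path between $v_i$ and $v_j$ (so $d_{ii}=0$). $G$ is called distance integral if all eigenvalues of $D(G)$ are integers. For distinct positive integers $p_1<\dots<p_s$ and positive integers $a_1,\dots,a_s$, $K_{a_1\cdot p_1,\dots,a_s\cdot p_s}$ denotes the complete multipartite graph having exactly $a_i$ parts of size $p_i$ for each $i=1,\dots,s$ (two vertices are adjacent if and only if they lie in different parts). It has $\sum_i a_i$ parts and $\sum_i a_ip_i$ vertices. -}

module Defs where

open import Level using (Level; _⊔_) renaming (suc to lsuc; zero to lzero)
open import Algebra.Apartness.Bundles using (HeytingField; HeytingCommutativeRing)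
open import Algebra.Bundles using (CommutativeRing)
open import Data.Fin.Base as Fin using (Fin; zero; suc; punchIn)
open import Data.Integer.Base as ℤ using (ℤ; +_; -[1+_])
import Data.Integer.Properties as ℤ
open import Data.List.Base as List using (List)
open import Data.List.Relation.Unary.Unique.Propositional using (Unique)
open import Data.Nat.Base as ℕ using (ℕ; suc; _+_; _*_; _≤_)
open import Data.Nat.ListAction using () renaming (sum to sumᴸ)
import Data.Nat.Properties as ℕ
open import Data.Product.Base using (Σ-syntax; ∃-syntax; _×_)
open import Data.Sum.Base using ([_,_])
open import Data.Vec.Functional using (Vector; _∷_; [])
open import Function.Base using (_∘_; const)
open import Relation.Binary.Construct.Closure.ReflexiveTransitive
  using (Star; ε; _◅_)
open import Relation.Binary.Core using (Rel)
open import Relation.Binary.Definitions using (Symmetric; Irreflexive)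
open import Relation.Binary.PropositionalEquality
  using (_≡_; _≢_; cong; ≢-sym)
open import Relation.Nullary.Negation using (¬_)

import Algebra.Properties.Monoid.Mult as Mult
import Algebra.Properties.Monoid.Sum as Sum

open Sum ℕ.+-0-monoid public using () renaming (sum to ∑ℕ)
open Sum ℤ.*-1-monoid public using () renaming (sum to ∏ℤ)

record Graph : Set₁ where
  field
    order  : ℕ
    Adj    : Rel (Fin order) lzero
    sym    : Symmetric Adj
    irrefl : Irreflexive _≡_ Adj

module _ (G : Graph) where
  open Graph G

  Walk : Rel (Fin order) lzero
  Walk = Star Adj

  length : ∀ {i j} → Walk i j → ℕ
  length ε       = 0
  length (_ ◅ w) = suc (length w)

  vertices : ∀ {i j} → Walk i j → List (Fin order)
  vertices {i} ε       = List.[ i ]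
  vertices {i} (_ ◅ w) = i List.∷ vertices w

  IsPath : ∀ {i j} → Walk i j → Set
  IsPath w = Unique (vertices w)

  IsDistance : (i j : Fin order) → ℕ → Set
  IsDistance i j d =
    (Σ[ w ∈ Walk i j ] (IsPath w × length w ≡ d)) ×
    (∀ (w : Walk i j) → IsPath w → d ≤ length w)

  -- Such a matrix is unique, and it exists only if G is connected.
  IsDistanceMatrix : (Fin order → Fin order → ℕ) → Set
  IsDistanceMatrix D = ∀ i j → IsDistance i j (D i j)

module _ {c ℓ₁ ℓ₂} (F : HeytingField c ℓ₁ ℓ₂) where
  open HeytingField F
    using (Carrier; _≈_; _#_; -_; 0#; 1#; heytingCommutativeRing)
    renaming (_*_ to _·_)
  open CommutativeRing (HeytingCommutativeRing.commutativeRing heytingCommutativeRing)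
    using (+-monoid)
  open Mult +-monoid using () renaming (_×_ to _×ᶠ_)
  open Sum +-monoid using (sum)

  fromℕ : ℕ → Carrier
  fromℕ n = n ×ᶠ 1#

  fromℤ : ℤ → Carrier
  fromℤ (+ n)    = fromℕ n
  fromℤ -[1+ n ] = - fromℕ (suc n)

  CharacteristicZero : Set ℓ₂
  CharacteristicZero = ∀ n → fromℕ (suc n) # 0#

  IsEigenvalue : ∀ {n} → (Fin n → Fin n → ℕ) → Carrier → Set (c ⊔ ℓ₁)
  IsEigenvalue {n} M x =
    Σ[ v ∈ Vector Carrier n ]
      (¬ (∀ i → v i ≈ 0#)) ×
      (∀ i → sum (λ j → fromℕ (M i j) · v j) ≈ x · v i)

  IsInteger : Carrier → Set ℓ₁
  IsInteger x = ∃[ m ] x ≈ fromℤ m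

-- There is no library type of real or complex numbers to take eigenvalues
-- in.  They are therefore taken in an arbitrary field of characteristic zero;
-- ℝ and ℂ are instances.
DistanceIntegral : (c ℓ₁ ℓ₂ : Level) → Graph → Set (lsuc (c ⊔ ℓ₁ ⊔ ℓ₂))
DistanceIntegral c ℓ₁ ℓ₂ G =
  Σ[ D ∈ (Fin (Graph.order G) → Fin (Graph.order G) → ℕ) ]
    IsDistanceMatrix G D ×
    (∀ (F : HeytingField c ℓ₁ ℓ₂) → CharacteristicZero F →
     ∀ x → IsEigenvalue F D x → IsInteger F x)

-- The vertices are numbered part by part; `part ps v` is the index of the
-- part containing v when the part sizes are ps.
part : (ps : List ℕ) → Fin (sumᴸ ps) → Fin (List.length ps)
part (m List.∷ ps) v = [ const zero , suc ∘ part ps ] (Fin.splitAt m v)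

completeMultipartite : List ℕ → Graph
completeMultipartite ps = record
  { order  = sumᴸ ps
  ; Adj    = λ u v → part ps u ≢ part ps v
  ; sym    = ≢-sym
  ; irrefl = λ u≡v ps≢ → ps≢ (cong (part ps) u≡v)
  }

-- K[ a · p ] is the complete multipartite graph with a i parts of size p i.
K[_·_] : ∀ {s} → Vector ℕ s → Vector ℕ s → Graph
K[ a · p ] = completeMultipartite
  (List.concat (List.tabulate λ i → List.replicate (a i) (p i)))

p : Vector ℕ 5
p = 1 ∷ 4 ∷ 8 ∷ 18 ∷ 31 ∷ []

μ : ℕ → Vector ℕ 5
μ t = 1 ∷ 5 ∷ 14 ∷ 20 ∷ 9298 + 13236132 * t ∷ []

a : ℕ → Vector ℕ 5
a t = 4671576 * t + 3282
    ∷ 472719 * t + 332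
    ∷ 143871 * t + 101
    ∷ 31372 * t + 22
    ∷ 159936 * t + 112
    ∷ []

n : ℕ → ℕ
n t = ∑ℕ λ i → a t i * p i

numerator : ℕ → Fin 5 → ℤ
numerator t k = ∏ℤ λ i → + μ t i ℤ.- + p k ℤ.+ + 2

-- The indices i ≠ k are enumerated as punchIn k i, for i : Fin 4.
denominator : Fin 5 → ℤ
denominator k = + p k ℤ.* ∏ℤ λ (i : Fin 4) → + p (punchIn k i) ℤ.- + p k

{-# OPTIONS --safe #-}
module Submission where

-- Put y = x + 2 for an eigenvalue x of the distance matrix with eigenvector v.
-- If S is the sum of v and T P its sum over the part P, of size m, then
-- y v_i = S + T (part of i) and (y − m) T P = m S.  Multiplying by the other
-- factors of ∏ (y − q p_k) and summing over all parts gives Q(y) S = 0, where for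
-- the given data Q(y) = ∏ (y − q (μ_i + 2)).  So if y is apart from 0, from all
-- q p_k and from all q (μ_i + 2), then S, every T P and v vanish.  Hence y is
-- one of these integers.

open import Defs
open import Level using (Level)
open import Data.Fin.Base using (Fin; zero; suc; inject₁; punchIn; _↑ˡ_; _↑ʳ_)
open import Data.Integer.Base as ℤ using (ℤ; +_; -[1+_]; 0ℤ)
open import Data.Nat.Base as ℕ using (ℕ; zero; suc; _+_; _*_; _>_; _≤_; _<_; z≤n; s≤s)
open import Data.Product.Base using (∃-syntax; _×_; _,_; proj₁)
open import Relation.Binary.PropositionalEquality as ≡ using (_≡_; _≢_)

import Algebra.Apartness.Properties.HeytingCommutativeRing as HeytingProperties
import Algebra.Properties.CommutativeMonoid.Sum as CommutativeMonoidSum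
import Algebra.Properties.Monoid.Mult as MonoidMult
import Algebra.Properties.Monoid.Sum as MonoidSum
import Algebra.Properties.Ring as RingProperties
import Algebra.Properties.Semiring.Mult as SemiringMult
import Algebra.Properties.Semiring.Sum as SemiringSum
import Algebra.Solver.Ring
import Data.Fin.Properties as Fin
import Data.Integer.Properties as ℤ
import Data.List.Properties as List
import Data.List.Relation.Unary.All.Properties as All
import Data.Nat.Properties as ℕ
import Relation.Binary.Reasoning.Setoid as SetoidReasoning
open import Algebra.Apartness.Bundles using (HeytingField; HeytingCommutativeRing)
open import Algebra.Bundles using (CommutativeRing; CommutativeSemiring; Monoid; RawRing)
open import Algebra.Solver.Ring.AlmostCommutativeRing
  using (_-Raw-AlmostCommutative⟶_; fromCommutativeSemiring)
open import Data.Integer.Solver using (module +-*-Solver)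
open import Data.List.Base as List using (List; []; _∷_)
open import Data.List.Membership.Propositional.Properties using (∈-lookup)
open import Data.List.Relation.Unary.All as All using (All; []; _∷_)
open import Data.List.Relation.Unary.AllPairs using ([]; _∷_)
open import Data.Maybe.Base as Maybe using (Maybe)
open import Data.Nat.ListAction using () renaming (sum to sumᴸ)
open import Data.Nat.ListAction.Properties using (sum-++)
open import Data.Sum.Base using (_⊎_; inj₁; inj₂; [_,_])
open import Data.Vec.Functional as Vector using (Vector; removeAt)
open import Function.Base using (_∘_)
open import Relation.Binary.Construct.Closure.ReflexiveTransitive using (ε; _◅_)
open import Relation.Nullary using (¬_; yes; no; ¬?; contradiction)
open import Relation.Nullary.Decidable using (dec⇒maybe; from-yes)

-- Kronecker delta and sums over a list of parts.

parts : ∀ {s} → Vector ℕ s → Vector ℕ s → List ℕ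
parts a p = List.concat (List.tabulate λ i → List.replicate (a i) (p i))

-- Valued in `ℕ`, so that it combines with distances before any field is chosen.
δ : ∀ {k} → Fin k → Fin k → ℕ
δ zero    zero    = 1
δ zero    (suc _) = 0
δ (suc _) zero    = 0
δ (suc i) (suc j) = δ i j

δ-refl : ∀ {k} (i : Fin k) → δ i i ≡ 1
δ-refl zero    = ≡.refl
δ-refl (suc i) = δ-refl i

δ-≢ : ∀ {k} {i j : Fin k} → i ≢ j → δ i j ≡ 0
δ-≢ {i = zero}  {zero}  i≢j = contradiction ≡.refl i≢j
δ-≢ {i = zero}  {suc j} i≢j = ≡.refl
δ-≢ {i = suc i} {zero}  i≢j = ≡.refl
δ-≢ {i = suc i} {suc j} i≢j = δ-≢ (i≢j ∘ ≡.cong suc)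

module _ {c ℓ} (M : Monoid c ℓ) where
  open Monoid M
  open MonoidSum M using (sum)
  open MonoidMult M using () renaming (_×_ to _×ᴹ_)

  sum-splitAt : ∀ m {k} (f : Vector Carrier (m + k)) →
    sum f ≈ sum (f ∘ (_↑ˡ k)) ∙ sum (f ∘ (m ↑ʳ_))
  sum-splitAt zero    f = sym (identityˡ _)
  sum-splitAt (suc m) f = trans (∙-congˡ (sum-splitAt m (f ∘ suc))) (sym (assoc _ _ _))

  -- Collects the `a i` equal terms of each block. The hypothesis on `f` speaks only of the size of
  -- a part, so no position in the list has to be traced back to its block.
  sum-parts : ∀ {s} (a p : Vector ℕ s) (g : Vector Carrier s)
    (f : Vector Carrier (List.length (parts a p))) →
    (∀ P i → List.lookup (parts a p) P ≡ p i → f P ≈ g i) →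
    sum f ≈ sum (λ i → a i ×ᴹ g i)
  sum-parts {zero}  a p g f f≈g = refl
  sum-parts {suc s} a p g f f≈g = go (a zero) f f≈g
    where
    rest = parts (a ∘ suc) (p ∘ suc)
    go : ∀ b (f : Vector Carrier (List.length (List.replicate b (p zero) List.++ rest))) →
      (∀ P i → List.lookup (List.replicate b (p zero) List.++ rest) P ≡ p i → f P ≈ g i) →
      sum f ≈ (b ×ᴹ g zero) ∙ sum (λ i → a (suc i) ×ᴹ g (suc i))
    go zero    f f≈g = trans
      (sum-parts (a ∘ suc) (p ∘ suc) (g ∘ suc) f (λ P i → f≈g P (suc i)))
      (sym (identityˡ _))
    go (suc b) f f≈g = trans
      (∙-cong (f≈g zero zero ≡.refl) (go b (f ∘ suc) (f≈g ∘ suc)))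
      (sym (assoc _ _ _))

lookup-parts : ∀ {s} (a p : Vector ℕ s) P → ∃[ i ] List.lookup (parts a p) P ≡ p i
lookup-parts a p P = All.lookup {P = λ m → ∃[ i ] m ≡ p i}
  (All.concat⁺ (All.tabulate⁺ λ i → All.replicate⁺ (a i) (i , ≡.refl)))
  (∈-lookup P)

-- Distances in a complete multipartite graph.

module Distance (ps : List ℕ) (other-part : ∀ u → ∃[ w ] part ps u ≢ part ps w) where

  K : Graph
  K = completeMultipartite ps

  D : Fin (sumᴸ ps) → Fin (sumᴸ ps) → ℕ
  D u v with u Fin.≟ v | part ps u Fin.≟ part ps v
  ... | yes _ | _     = 0
  ... | no _  | yes _ = 2
  ... | no _  | no _  = 1

  -- Entrywise form of D + 2I = J + B, with J the all-ones matrix and B the indicator of lying in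
  -- the same part. The term 2I is on the left to avoid subtraction in `ℕ`.
  D-entry : ∀ u v → D u v + 2 * δ u v ≡ 1 + δ (part ps v) (part ps u)
  D-entry u v with u Fin.≟ v | part ps u Fin.≟ part ps v
  ... | yes ≡.refl | _ rewrite δ-refl u | δ-refl (part ps u) = ≡.refl
  ... | no u≢v | yes eq rewrite δ-≢ u≢v | eq | δ-refl (part ps v) = ≡.refl
  ... | no u≢v | no neq rewrite δ-≢ u≢v | δ-≢ (neq ∘ ≡.sym) = ≡.refl

  isDistanceMatrix : IsDistanceMatrix K D
  isDistanceMatrix u v with u Fin.≟ v | part ps u Fin.≟ part ps v
  ... | yes ≡.refl | _ = (ε , [] ∷ [] , ≡.refl) , λ _ _ → z≤n
  ... | no u≢v | no neq = (neq ◅ ε , (u≢v ∷ []) ∷ [] ∷ [] , ≡.refl) , λ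
    { ε _       → contradiction ≡.refl u≢v
    ; (_ ◅ _) _ → s≤s z≤n }
  -- Distinct vertices of one part are not adjacent, but any vertex `w` of another part is a common
  -- neighbour.
  ... | no u≢v | yes eq with other-part u
  ...   | w , u≁w =
    ( u≁w ◅ (λ w~v → u≁w (≡.trans eq (≡.sym w~v))) ◅ ε
    , ((u≁w ∘ ≡.cong (part ps)) ∷ u≢v ∷ [])
      ∷ ((λ w≡v → u≁w (≡.trans eq (≡.cong (part ps) (≡.sym w≡v)))) ∷ []) ∷ [] ∷ []
    , ≡.refl) , λ
    { ε _           → contradiction ≡.refl u≢v
    ; (u~v ◅ ε) _   → contradiction eq u~v
    ; (_ ◅ _ ◅ _) _ → s≤s (s≤s z≤n) }

part-surjective : ∀ {ps} → All (0 <_) ps → ∀ P → ∃[ w ] part ps w ≡ P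
part-surjective {suc m ∷ ps} (_ ∷ _) zero = zero , ≡.refl
part-surjective {m ∷ ps} (_ ∷ ps>0) (suc P) with part-surjective ps>0 P
... | w , eq = m ↑ʳ w , ≡.trans
  (≡.cong [ (λ _ → zero) , suc ∘ part ps ] (Fin.splitAt-↑ʳ m (sumᴸ ps) w)) (≡.cong suc eq)

other : ∀ {k} → 2 ≤ k → (P : Fin k) → ∃[ Q ] P ≢ Q
other (s≤s (s≤s _)) zero    = suc zero , λ ()
other (s≤s (s≤s _)) (suc _) = zero , λ ()

other-part : ∀ {ps} → All (0 <_) ps → 2 ≤ List.length ps → ∀ u → ∃[ w ] part ps u ≢ part ps w
other-part {ps} ps>0 2≤k u with other 2≤k (part ps u)
... | Q , u∉Q with part-surjective ps>0 Q
...   | w , eq = w , λ u~w → u∉Q (≡.trans u~w eq)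

-- Positivity, number and total size of the parts.

parts-positive : ∀ {s} (a p : Vector ℕ s) → (∀ i → 0 < p i) → All (0 <_) (parts a p)
parts-positive a p p>0 = All.concat⁺ (All.tabulate⁺ λ i → All.replicate⁺ (a i) (p>0 i))

first≤length-parts : ∀ {s} (a p : Vector ℕ (suc s)) → a zero ≤ List.length (parts a p)
first≤length-parts a p = ≡.subst (a zero ≤_)
  (≡.sym (≡.trans (List.length-++ (List.replicate (a zero) (p zero)))
                  (≡.cong (_+ List.length (parts (a ∘ suc) (p ∘ suc))) (List.length-replicate (a zero)))))
  (ℕ.m≤m+n (a zero) _)

sumᴸ-replicate : ∀ m k → sumᴸ (List.replicate m k) ≡ m * k
sumᴸ-replicate zero    k = ≡.refl
sumᴸ-replicate (suc m) k = ≡.cong (λ z → k + z) (sumᴸ-replicate m k)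

order-parts : ∀ {s} (a p : Vector ℕ s) → sumᴸ (parts a p) ≡ ∑ℕ λ i → a i * p i
order-parts {zero}  a p = ≡.refl
order-parts {suc s} a p = ≡.trans
  (sum-++ (List.replicate (a zero) (p zero)) _)
  (≡.cong₂ _+_ (sumᴸ-replicate (a zero) (p zero)) (order-parts (a ∘ suc) (p ∘ suc)))

order-scaled : ∀ {s} (a p : Vector ℕ s) q →
  sumᴸ (parts a (λ i → p i * q)) ≡ q * ∑ℕ λ i → a i * p i
order-scaled a p q = ≡.trans (order-parts a (λ i → p i * q)) (≡.trans
  (MonoidSum.sum-cong-≗ ℕ.+-0-monoid λ i → ≡.trans
    (≡.sym (ℕ.*-assoc (a i) (p i) q)) (ℕ.*-comm (a i * p i) q))
  (≡.sym (SemiringSum.*-distribˡ-sum ℕ.+-*-semiring q (λ i → a i * p i))))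

-- Natural numbers and apartness in a Heyting field of characteristic zero.

module Spectrum {c ℓ₁ ℓ₂} (F : HeytingField c ℓ₁ ℓ₂) (char0 : CharacteristicZero F) where

  private
    hcr = HeytingField.heytingCommutativeRing F

  commutativeRing : CommutativeRing c ℓ₁
  commutativeRing = HeytingCommutativeRing.commutativeRing hcr

  open HeytingField F using (_#_; tight; #-sym; #-cotrans; #⇒invertible; invertible⇒#)
  open HeytingProperties hcr
  open CommutativeRing commutativeRing hiding (zero)
    renaming (_+_ to infixl 6 _⊹_; _*_ to infixl 7 _·_; _-_ to infixl 6 _⊖_; -_ to infix 8 ⊝_)
  open RingProperties ring
  open SemiringMult semiring using (×-homo-+; ×1-homo-*; ×-assoc-*) renaming (_×_ to _×ᶠ_)
  open SemiringSum semiring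
    using (sum; sum-cong-≋; ∑-comm; ∑-distrib-+; *-distribˡ-sum; *-distribʳ-sum; sum-replicate-zero; sum-replicate)
  module Product = CommutativeMonoidSum *-commutativeMonoid
  open Product using () renaming (sum to product)
  open SetoidReasoning setoid

  ι : ℕ → Carrier
  ι = fromℕ F

  ι-+ : ∀ m n → ι (m + n) ≈ ι m ⊹ ι n
  ι-+ = ×-homo-+ 1#

  ι-* : ∀ m n → ι (m * n) ≈ ι m · ι n
  ι-* = ×1-homo-*

  ι-1 : ι 1 ≈ 1#
  ι-1 = +-identityʳ 1#

  ×ᶠ≈ι· : ∀ n x → n ×ᶠ x ≈ ι n · x
  ×ᶠ≈ι· n x = sym (trans (×-assoc-* n 1# x) (SemiringMult.×-congʳ semiring n (*-identityˡ x)))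

  -- Apartness is invertibility of the difference, hence depends on the difference alone.
  #-resp-difference : ∀ {a b c d} → a ⊖ b ≈ c ⊖ d → a # b → c # d
  #-resp-difference eq a#b with #⇒invertible a#b
  ... | u , ul , ur = invertible⇒#
    (u , trans (*-congˡ (sym eq)) ul , trans (*-congʳ (sym eq)) ur)

  #⇒difference#0 : ∀ {a b} → a # b → a ⊖ b # 0#
  #⇒difference#0 = #-resp-difference (sym (x-0≈x _))

  ι-suc-difference : ∀ m n → ι m ⊖ ι n ≈ ι (suc m) ⊖ ι (suc n)
  ι-suc-difference m n = sym (begin
    (1# ⊹ ι m) ⊖ (1# ⊹ ι n)        ≈⟨ +-congˡ (-‿+-comm _ _) ⟨
    (1# ⊹ ι m) ⊹ (⊝ 1# ⊹ ⊝ ι n)    ≈⟨ +-assoc _ _ _ ⟨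
    1# ⊹ ι m ⊹ ⊝ 1# ⊖ ι n          ≈⟨ +-congʳ (xyx⁻¹≈y 1# (ι m)) ⟩
    ι m ⊖ ι n                      ∎)

  ι-# : ∀ {m n} → m ≢ n → ι m # ι n
  ι-# {zero}  {zero}  m≢n = contradiction ≡.refl m≢n
  ι-# {zero}  {suc n} m≢n = #-sym (char0 n)
  ι-# {suc m} {zero}  m≢n = char0 m
  ι-# {suc m} {suc n} m≢n = #-resp-difference (ι-suc-difference m n) (ι-# (m≢n ∘ ≡.cong suc))

  #0-cancel : ∀ {a b} → a # 0# → a · b ≈ 0# → b ≈ 0#
  #0-cancel {a} {b} a#0 ab≈0 with #⇒invertible a#0
  ... | u , u[a-0]≈1 , _ = begin
    b                ≈⟨ *-identityˡ b ⟨
    1# · b           ≈⟨ *-congʳ u[a-0]≈1 ⟨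
    u · (a ⊖ 0#) · b ≈⟨ *-congʳ (*-congˡ (x-0≈x a)) ⟩
    u · a · b        ≈⟨ *-assoc u a b ⟩
    u · (a · b)      ≈⟨ *-congˡ ab≈0 ⟩
    u · 0#           ≈⟨ zeroʳ u ⟩
    0#               ∎

  product-#0 : ∀ {k} (f : Vector Carrier k) → (∀ i → f i # 0#) → product f # 0#
  product-#0 {zero}  f f#0 = 1#0
  product-#0 {suc k} f f#0 = x#0y#0→xy#0 (f#0 zero) (product-#0 (f ∘ suc) (f#0 ∘ suc))

  -- Cotransitivity separates y from at least one of any two distinct integers.
  apart-from-all-but-one : ∀ y rs → ∃[ c ] All (λ r → r ≡ c ⊎ y # ι r) rs
  apart-from-all-but-one y []       = 0 , []
  apart-from-all-but-one y (r ∷ rs) with apart-from-all-but-one y rs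
  ... | c , rest with r ℕ.≟ c
  ...   | yes r≡c = c , inj₁ r≡c ∷ rest
  ...   | no r≢c with #-cotrans (ι-# r≢c) y
  ...     | inj₁ r#y = c , inj₂ (#-sym r#y) ∷ rest
  ...     | inj₂ y#c = r , inj₁ ≡.refl ∷
    All.map (λ { (inj₁ ≡.refl) → inj₂ y#c ; (inj₂ y#r) → inj₂ y#r }) rest

  -- Equality in the field is not decidable, so no case split on `y` is possible. Instead a single
  -- candidate `c` is left over, and tightness turns the impossibility of `y # ι c` into equality.
  one-of : ∀ y rs → ¬ All (λ r → y # ι r) rs → ∃[ c ] y ≈ ι c
  one-of y rs not-all with apart-from-all-but-one y rs
  ... | c , rest = c , proj₁ (tight y (ι c)) (λ y#c → not-all
    (All.map (λ { (inj₁ ≡.refl) → y#c ; (inj₂ y#r) → y#r }) rest))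

  -- Eigenvector equations, by vertex and by part.

  sum-δ : ∀ {k} (i : Fin k) (f : Vector Carrier k) → sum (λ j → ι (δ i j) · f j) ≈ f i
  sum-δ {suc k} zero f = begin
    ι 1 · f zero ⊹ sum (λ j → 0# · f (suc j)) ≈⟨ +-cong (trans (*-congʳ ι-1) (*-identityˡ _)) (sum-cong-≋ {k} (λ j → zeroˡ (f (suc j)))) ⟩
    f zero ⊹ sum {k} (λ _ → 0#)               ≈⟨ +-congˡ (sum-replicate-zero k) ⟩
    f zero ⊹ 0#                               ≈⟨ +-identityʳ _ ⟩
    f zero                                    ∎
  sum-δ {suc k} (suc i) f = begin
    0# · f zero ⊹ sum (λ j → ι (δ i j) · f (suc j)) ≈⟨ +-cong (zeroˡ _) (sum-δ i (f ∘ suc)) ⟩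
    0# ⊹ f (suc i)                                  ≈⟨ +-identityˡ _ ⟩
    f (suc i)                                       ∎

  part-size : ∀ ps P → sum (λ j → ι (δ (part ps j) P)) ≈ ι (List.lookup ps P)
  part-size (m ∷ ps) P = begin
    sum (λ j → ι (δ (part (m ∷ ps) j) P))
      ≈⟨ sum-splitAt +-monoid m _ ⟩
    sum (λ j → ι (δ (part (m ∷ ps) (j ↑ˡ sumᴸ ps)) P)) ⊹ sum (λ j → ι (δ (part (m ∷ ps) (m ↑ʳ j)) P))
      ≈⟨ +-cong
           (sum-cong-≋ λ j → reflexive (≡.cong (λ z → ι (δ ([ (λ _ → zero) , suc ∘ part ps ] z) P)) (Fin.splitAt-↑ˡ m j (sumᴸ ps))))
           (sum-cong-≋ λ j → reflexive (≡.cong (λ z → ι (δ ([ (λ _ → zero) , suc ∘ part ps ] z) P)) (Fin.splitAt-↑ʳ m (sumᴸ ps) j))) ⟩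
    sum {m} (λ _ → ι (δ zero P)) ⊹ sum (λ j → ι (δ (suc (part ps j)) P))
      ≈⟨ by-part P ⟩
    ι (List.lookup (m ∷ ps) P) ∎
    where
    by-part : ∀ P → sum {m} (λ _ → ι (δ zero P)) ⊹ sum (λ j → ι (δ (suc (part ps j)) P))
                    ≈ ι (List.lookup (m ∷ ps) P)
    by-part zero = begin
      sum {m} (λ _ → ι 1) ⊹ sum {sumᴸ ps} (λ _ → 0#) ≈⟨ +-cong (sum-replicate m) (sum-replicate-zero (sumᴸ ps)) ⟩
      m ×ᶠ ι 1 ⊹ 0#                                  ≈⟨ +-identityʳ _ ⟩
      m ×ᶠ ι 1                                       ≈⟨ SemiringMult.×-congʳ semiring m ι-1 ⟩
      ι m                                            ∎
    by-part (suc P) = begin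
      sum {m} (λ _ → 0#) ⊹ sum (λ j → ι (δ (part ps j) P)) ≈⟨ +-cong (sum-replicate-zero m) (part-size ps P) ⟩
      0# ⊹ ι (List.lookup ps P)                            ≈⟨ +-identityˡ _ ⟩
      ι (List.lookup ps P)                                 ∎

  ·-swap : ∀ a b c → a · (b · c) ≈ b · (a · c)
  ·-swap a b c = trans (sym (*-assoc a b c)) (trans (*-congʳ (*-comm a b)) (*-assoc b a c))

  module Eigenvector
    (ps : List ℕ) (D : Fin (sumᴸ ps) → Fin (sumᴸ ps) → ℕ)
    (D-entry : ∀ i j → D i j + 2 * δ i j ≡ 1 + δ (part ps j) (part ps i))
    (x : Carrier) (v : Vector Carrier (sumᴸ ps))
    (Dv≈xv : ∀ i → sum (λ j → ι (D i j) · v j) ≈ x · v i) where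

    y S : Carrier
    y = x ⊹ ι 2
    S = sum v

    T : Vector Carrier (List.length ps)
    T P = sum (λ j → ι (δ (part ps j) P) · v j)

    entry : ∀ i j → ι (D i j) · v j ⊹ ι 2 · (ι (δ i j) · v j) ≈ v j ⊹ ι (δ (part ps j) (part ps i)) · v j
    entry i j = begin
      ι (D i j) · v j ⊹ ι 2 · (ι (δ i j) · v j)        ≈⟨ +-congˡ (*-assoc _ _ _) ⟨
      ι (D i j) · v j ⊹ ι 2 · ι (δ i j) · v j          ≈⟨ distribʳ _ _ _ ⟨
      (ι (D i j) ⊹ ι 2 · ι (δ i j)) · v j              ≈⟨ *-congʳ (+-congˡ (ι-* 2 (δ i j))) ⟨
      (ι (D i j) ⊹ ι (2 * δ i j)) · v j                ≈⟨ *-congʳ (ι-+ (D i j) (2 * δ i j)) ⟨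
      ι (D i j + 2 * δ i j) · v j                      ≈⟨ *-congʳ (reflexive (≡.cong ι (D-entry i j))) ⟩
      (1# ⊹ ι (δ (part ps j) (part ps i))) · v j       ≈⟨ distribʳ _ _ _ ⟩
      1# · v j ⊹ ι (δ (part ps j) (part ps i)) · v j   ≈⟨ +-congʳ (*-identityˡ _) ⟩
      v j ⊹ ι (δ (part ps j) (part ps i)) · v j        ∎

    -- Row `i` of (D + 2I) v = (J + B) v.
    row : ∀ i → y · v i ≈ S ⊹ T (part ps i)
    row i = begin
      (x ⊹ ι 2) · v i                                                       ≈⟨ distribʳ _ _ _ ⟩
      x · v i ⊹ ι 2 · v i                                                   ≈⟨ +-cong (Dv≈xv i) (*-congˡ (sum-δ i v)) ⟨
      sum (λ j → ι (D i j) · v j) ⊹ ι 2 · sum (λ j → ι (δ i j) · v j)       ≈⟨ +-congˡ (*-distribˡ-sum (ι 2) (λ j → ι (δ i j) · v j)) ⟩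
      sum (λ j → ι (D i j) · v j) ⊹ sum (λ j → ι 2 · (ι (δ i j) · v j))     ≈⟨ ∑-distrib-+ (λ j → ι (D i j) · v j) (λ j → ι 2 · (ι (δ i j) · v j)) ⟨
      sum (λ j → ι (D i j) · v j ⊹ ι 2 · (ι (δ i j) · v j))                 ≈⟨ sum-cong-≋ (entry i) ⟩
      sum (λ j → v j ⊹ ι (δ (part ps j) (part ps i)) · v j)                 ≈⟨ ∑-distrib-+ v (λ j → ι (δ (part ps j) (part ps i)) · v j) ⟩
      S ⊹ T (part ps i)                                                     ∎

    -- Used to make the factor `S ⊹ T (part ps j)` constant in `j`, so that it leaves the sum over a
    -- part.
    δ-transport : ∀ {k} (P Q : Fin k) (f : Fin k → Carrier) → ι (δ P Q) · f P ≈ ι (δ P Q) · f Q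
    δ-transport P Q f with P Fin.≟ Q
    ... | yes ≡.refl = refl
    ... | no P≢Q rewrite δ-≢ P≢Q = trans (zeroˡ _) (sym (zeroˡ _))

    -- Adding `row` over the `m` vertices of `P` gives `y · T P ≈ m · (S ⊹ T P)`; then `m · T P`
    -- moves to the left.
    part-sum : ∀ P → (y ⊖ ι (List.lookup ps P)) · T P ≈ ι (List.lookup ps P) · S
    part-sum P = begin
      (y ⊖ m) · T P             ≈⟨ [y-z]x≈yx-zx (T P) y m ⟩
      y · T P ⊖ m · T P         ≈⟨ +-congʳ y·T ⟩
      m · (S ⊹ T P) ⊖ m · T P   ≈⟨ +-congʳ (distribˡ m S (T P)) ⟩
      m · S ⊹ m · T P ⊖ m · T P ≈⟨ //-rightDividesʳ (m · T P) (m · S) ⟩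
      m · S                     ∎
      where
      m = ι (List.lookup ps P)
      y·T : y · T P ≈ m · (S ⊹ T P)
      y·T = begin
        y · T P                                                       ≈⟨ *-distribˡ-sum y (λ j → ι (δ (part ps j) P) · v j) ⟩
        sum (λ j → y · (ι (δ (part ps j) P) · v j))                   ≈⟨ sum-cong-≋ (λ j → ·-swap y _ (v j)) ⟩
        sum (λ j → ι (δ (part ps j) P) · (y · v j))                   ≈⟨ sum-cong-≋ (λ j → *-congˡ (row j)) ⟩
        sum (λ j → ι (δ (part ps j) P) · (S ⊹ T (part ps j)))         ≈⟨ sum-cong-≋ (λ j → δ-transport (part ps j) P (λ Q → S ⊹ T Q)) ⟩
        sum (λ j → ι (δ (part ps j) P) · (S ⊹ T P))                   ≈⟨ *-distribʳ-sum (S ⊹ T P) (λ j → ι (δ (part ps j) P)) ⟨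
        sum (λ j → ι (δ (part ps j) P)) · (S ⊹ T P)                   ≈⟨ *-congʳ (part-size ps P) ⟩
        m · (S ⊹ T P)                                                 ∎

    -- Each vertex lies in exactly one part, so exchanging the two sums leaves every `v j` once.
    sum-T : sum T ≈ S
    sum-T = begin
      sum T                                                    ≈⟨ ∑-comm (λ P j → ι (δ (part ps j) P) · v j) ⟩
      sum (λ j → sum (λ P → ι (δ (part ps j) P) · v j))        ≈⟨ sum-cong-≋ (λ j → sum-δ (part ps j) (λ _ → v j)) ⟩
      S                                                        ∎

    v≈0 : y # 0# → (∀ P → y # ι (List.lookup ps P)) → S ≈ 0# → ∀ i → v i ≈ 0#
    v≈0 y#0 y#m S≈0 i = #0-cancel y#0 (begin
      y · v i           ≈⟨ row i ⟩
      S ⊹ T (part ps i) ≈⟨ +-cong S≈0 (#0-cancel (#⇒difference#0 (y#m P)) (begin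
          (y ⊖ ι (List.lookup ps P)) · T P ≈⟨ part-sum P ⟩
          ι (List.lookup ps P) · S         ≈⟨ *-congˡ S≈0 ⟩
          ι (List.lookup ps P) · 0#        ≈⟨ zeroʳ _ ⟩
          0#                               ∎)) ⟩
      0# ⊹ 0#           ≈⟨ +-identityˡ 0# ⟩
      0#                ∎)
      where P = part ps i

  -- From the quotient polynomial to integral eigenvalues.

  -- The characteristic polynomial of the quotient of D + 2I by the partition of
  -- the vertices according to the size of their part.
  quotientPolynomial : ∀ {s} → Vector ℕ (suc s) → Vector ℕ (suc s) → Carrier → Carrier
  quotientPolynomial a p y =
    product f ⊹ sum (λ k → ι (a k) · (⊝ ι (p k) · product (removeAt f k)))
    where
    f = λ k → y ⊖ ι (p k)

  -- The argument works for any part sizes and multiplicities whose quotient polynomial splits with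
  -- natural roots; `factorization` is where the particular data enter.
  module _ {s r} (a p : Vector ℕ (suc s)) (roots : Vector ℕ r)
    (factorization : ∀ y → quotientPolynomial a p y ≈ product (λ i → y ⊖ ι (roots i)))
    (D : Fin (sumᴸ (parts a p)) → Fin (sumᴸ (parts a p)) → ℕ)
    (D-entry : ∀ i j → D i j + 2 * δ i j ≡ 1 + δ (part (parts a p) j) (part (parts a p) i)) where

    module _ (x : Carrier) (v : Vector Carrier (sumᴸ (parts a p)))
      (Dv≈xv : ∀ i → sum (λ j → ι (D i j) · v j) ≈ x · v i) where
      open Eigenvector (parts a p) D D-entry x v Dv≈xv

      private
        f : Vector Carrier (suc s)
        f k = y ⊖ ι (p k)
        g : Vector Carrier (suc s)
        g k = ι (p k) · product (removeAt f k)

      -- `part-sum` multiplied by the factors other than `f k`. This replaces division by `f k`,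
      -- which is not known to be invertible here.
      product·T : ∀ P k → List.lookup (parts a p) P ≡ p k → product f · T P ≈ g k · S
      product·T P k eq = begin
        product f · T P                           ≈⟨ *-congʳ (Product.sum-remove {i = k} f) ⟩
        f k · product (removeAt f k) · T P        ≈⟨ *-congʳ (*-comm _ _) ⟩
        product (removeAt f k) · f k · T P        ≈⟨ *-assoc _ _ _ ⟩
        product (removeAt f k) · (f k · T P)      ≈⟨ *-congˡ (≡.subst (λ m → (y ⊖ ι m) · T P ≈ ι m · S) eq (part-sum P)) ⟩
        product (removeAt f k) · (ι (p k) · S)    ≈⟨ *-assoc _ _ _ ⟨
        product (removeAt f k) · ι (p k) · S      ≈⟨ *-congʳ (*-comm _ _) ⟩
        g k · S                                   ∎

      product·S : product f · S ≈ sum (λ k → ι (a k) · (g k · S))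
      product·S = begin
        product f · S                      ≈⟨ *-congˡ sum-T ⟨
        product f · sum T                  ≈⟨ *-distribˡ-sum (product f) T ⟩
        sum (λ P → product f · T P)        ≈⟨ sum-parts +-monoid a p (λ k → g k · S) _ product·T ⟩
        sum (λ k → a k ×ᶠ (g k · S))       ≈⟨ sum-cong-≋ (λ k → ×ᶠ≈ι· (a k) (g k · S)) ⟩
        sum (λ k → ι (a k) · (g k · S))    ∎

      quotientPolynomial·S : quotientPolynomial a p y · S ≈ 0#
      quotientPolynomial·S = begin
        (product f ⊹ sum h) · S                                            ≈⟨ distribʳ S (product f) (sum h) ⟩
        product f · S ⊹ sum h · S                                          ≈⟨ +-cong product·S (*-distribʳ-sum S h) ⟩
        sum (λ k → ι (a k) · (g k · S)) ⊹ sum (λ k → h k · S)              ≈⟨ ∑-distrib-+ (λ k → ι (a k) · (g k · S)) (λ k → h k · S) ⟨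
        sum (λ k → ι (a k) · (g k · S) ⊹ h k · S)                          ≈⟨ sum-cong-≋ cancel ⟩
        sum {suc s} (λ _ → 0#)                                             ≈⟨ sum-replicate-zero (suc s) ⟩
        0#                                                                 ∎
        where
        h = λ k → ι (a k) · (⊝ ι (p k) · product (removeAt f k))
        cancel : ∀ k → ι (a k) · (g k · S) ⊹ h k · S ≈ 0#
        cancel k = begin
          ι (a k) · (g k · S) ⊹ h k · S                  ≈⟨ +-congˡ (*-assoc _ _ S) ⟩
          ι (a k) · (g k · S) ⊹ ι (a k) · (⊝ ι (p k) · product (removeAt f k) · S) ≈⟨ distribˡ _ _ _ ⟨
          ι (a k) · (g k · S ⊹ ⊝ ι (p k) · product (removeAt f k) · S) ≈⟨ *-congˡ (distribʳ _ _ _) ⟨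
          ι (a k) · ((g k ⊹ ⊝ ι (p k) · product (removeAt f k)) · S) ≈⟨ *-congˡ (*-congʳ (distribʳ _ _ _)) ⟨
          ι (a k) · ((ι (p k) ⊖ ι (p k)) · product (removeAt f k) · S) ≈⟨ *-congˡ (*-congʳ (*-congʳ (-‿inverseʳ _))) ⟩
          ι (a k) · (0# · product (removeAt f k) · S) ≈⟨ *-congˡ (*-congʳ (zeroˡ _)) ⟩
          ι (a k) · (0# · S) ≈⟨ *-congˡ (zeroˡ S) ⟩
          ι (a k) · 0# ≈⟨ zeroʳ _ ⟩
          0# ∎

      eigenvector-trivial : y # 0# → (∀ k → y # ι (p k)) → (∀ i → y # ι (roots i)) → ∀ i → v i ≈ 0#
      eigenvector-trivial y#0 y#p y#roots = v≈0 y#0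
        (λ P → let k , eq = lookup-parts a p P in ≡.subst (λ m → y # ι m) (≡.sym eq) (y#p k))
        (#0-cancel
          (#-congʳ (sym (factorization y)) (product-#0 _ (#⇒difference#0 ∘ y#roots)))
          quotientPolynomial·S)

    eigenvalue-integer : ∀ x → IsEigenvalue F D x → IsInteger F x
    eigenvalue-integer x (v , v≉0 , Dv≈xv) = minus-two (one-of (x ⊹ ι 2) rs not-all)
      where
      -- The values of y = x + 2 at which one of the cancellations fails: 0 for passing from y v to
      -- v, the sizes for passing from S to T, the roots for S itself.
      rs = 0 ∷ List.tabulate p List.++ List.tabulate roots
      not-all : ¬ All (λ r → (x ⊹ ι 2) # ι r) rs
      not-all (y#0 ∷ y#rs) = v≉0 (eigenvector-trivial x v Dv≈xv y#0
        (All.tabulate⁻ {f = p} (All.++⁻ˡ (List.tabulate p) y#rs))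
        (All.tabulate⁻ {f = roots} (All.++⁻ʳ (List.tabulate p) y#rs)))
      minus-two : ∃[ c ] x ⊹ ι 2 ≈ ι c → IsInteger F x
      -- The values 0 and 1 of y give the negative integers -2 and -1, which `fromℤ` treats by a
      -- separate clause.
      minus-two (zero , eq) = -[1+ 1 ] , +-inverseˡ-unique x (ι 2) eq
      minus-two (suc zero , eq) = -[1+ 0 ] , +-inverseˡ-unique x (ι 1) (+-cancelˡ 1# _ _ (begin
        1# ⊹ (x ⊹ ι 1) ≈⟨ +-assoc _ _ _ ⟨
        1# ⊹ x ⊹ ι 1   ≈⟨ +-congʳ (+-comm 1# x) ⟩
        x ⊹ 1# ⊹ ι 1   ≈⟨ +-assoc _ _ _ ⟩
        x ⊹ ι 2        ≈⟨ eq ⟩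
        ι 1            ∎))
      minus-two (suc (suc c) , eq) = + c , +-cancelʳ (ι 2) _ _ (begin
        x ⊹ ι 2       ≈⟨ eq ⟩
        ι (2 + c)     ≈⟨ ι-+ 2 c ⟩
        ι 2 ⊹ ι c     ≈⟨ +-comm _ _ ⟩
        ι c ⊹ ι 2     ∎)

-- The polynomial identity behind the given data.

-- Coefficients of `a t` and `μ t` as linear functions of `t`, so that `t` can become a polynomial
-- variable.
a-slope a-offset μ-offset μ-slope : Vector ℕ 5
a-slope = 4671576 Vector.∷ 472719 Vector.∷ 143871 Vector.∷ 31372 Vector.∷ 159936 Vector.∷ Vector.[]
a-offset = 3282 Vector.∷ 332 Vector.∷ 101 Vector.∷ 22 Vector.∷ 112 Vector.∷ Vector.[]
μ-offset = 1 Vector.∷ 5 Vector.∷ 14 Vector.∷ 20 Vector.∷ 9298 Vector.∷ Vector.[]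
μ-slope = 0 Vector.∷ 0 Vector.∷ 0 Vector.∷ 0 Vector.∷ 13236132 Vector.∷ Vector.[]

-- Substituting w = − q turns the factorization into a semiring identity.  The
-- homomorphism ι is kept abstract so that the solver never unfolds the image of
-- a large numeral into a sum of ones.
module Identity {c ℓ} (R : CommutativeSemiring c ℓ) where

  open CommutativeSemiring R hiding (zero)
    renaming (_+_ to infixl 6 _⊹_; _*_ to infixl 7 _·_)

  module _
    (ι : ℕ → Carrier)
    (ι-+ : ∀ m n → ι (m + n) ≈ ι m ⊹ ι n)
    (ι-* : ∀ m n → ι (m * n) ≈ ι m · ι n)
    (ι-0 : ι 0 ≈ 0#) (ι-1 : ι 1 ≈ 1#) where

    open CommutativeMonoidSum +-commutativeMonoid using (sum)
    open CommutativeMonoidSum *-commutativeMonoid using () renaming (sum to product)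

    -- The negation is a dummy: it matches the identity map that `fromCommutativeSemiring` uses as
    -- negation.
    ℕ-rawRing : RawRing _ _
    ℕ-rawRing = record
      { Carrier = ℕ ; _≈_ = _≡_ ; _+_ = _+_ ; _*_ = _*_
      ; -_ = λ m → m ; 0# = 0 ; 1# = 1 }

    ι-hom : ℕ-rawRing -Raw-AlmostCommutative⟶ fromCommutativeSemiring R
    ι-hom = record
      { ⟦_⟧ = ι ; +-homo = ι-+ ; *-homo = ι-* ; -‿homo = λ _ → refl
      ; 0-homo = ι-0 ; 1-homo = ι-1 }

    _ι≟_ : ∀ m n → Maybe (ι m ≈ ι n)
    m ι≟ n = Maybe.map (λ m≡n → reflexive (≡.cong ι m≡n)) (dec⇒maybe (m ℕ.≟ n))

    open Algebra.Solver.Ring ℕ-rawRing _ ι-hom _ι≟_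

    -- The variable z stands for 0# and the power con 1 :^ 0 for 1#: con would
    -- denote ι 0 and ι 1, which are not definitionally equal to them.
    :∏ : ∀ {m k} → Vector (Polynomial m) k → Polynomial m
    :∏ = Vector.foldr _:*_ (con 1 :^ 0)

    :∑ : ∀ {m k} → Polynomial m → Vector (Polynomial m) k → Polynomial m
    :∑ z = Vector.foldr _:+_ z

    identity : ∀ y w τ →
      let f = λ k → y ⊹ ι (p k) · w in
      product f ⊹ sum (λ k → (ι (a-slope k) · τ ⊹ ι (a-offset k)) · (ι (p k) · w · product (removeAt f k)))
      ≈ product (λ k → y ⊹ (ι (μ-offset k) ⊹ ι (μ-slope k) · τ ⊹ ι 2) · w)
    identity y w τ = trans (solve 4 (λ y w τ z →
      let f = λ k → y :+ con (p k) :* w in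
      :∏ f :+ :∑ z (λ k → (con (a-slope k) :* τ :+ con (a-offset k)) :* (con (p k) :* w :* :∏ (removeAt f k)))
        -- The sum on the left ends in one `z`, so one `z` is added here; it disappears once `z` is
        -- `0#`.
        := :∏ (λ k → y :+ (con (μ-offset k) :+ con (μ-slope k) :* τ :+ con 2) :* w) :+ z)
      refl y w τ 0#) (+-identityʳ _)

a-linear : ∀ t k → a t k ≡ a-slope k * t + a-offset k
a-linear t zero                         = ≡.refl
a-linear t (suc zero)                   = ≡.refl
a-linear t (suc (suc zero))             = ≡.refl
a-linear t (suc (suc (suc zero)))       = ≡.refl
a-linear t (suc (suc (suc (suc zero)))) = ≡.refl

μ-linear : ∀ t k → μ t k ≡ μ-offset k + μ-slope k * t
μ-linear t zero                         = ≡.refl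
μ-linear t (suc zero)                   = ≡.refl
μ-linear t (suc (suc zero))             = ≡.refl
μ-linear t (suc (suc (suc zero)))       = ≡.refl
μ-linear t (suc (suc (suc (suc zero)))) = ≡.refl

-- Factorization and distance integrality for the given graphs.

module _ {c ℓ₁ ℓ₂} (F : HeytingField c ℓ₁ ℓ₂) (char0 : CharacteristicZero F) where

  open Spectrum F char0
  open CommutativeRing commutativeRing hiding (zero)
    renaming (_+_ to infixl 6 _⊹_; _*_ to infixl 7 _·_; _-_ to infixl 6 _⊖_; -_ to infix 8 ⊝_)
  open RingProperties ring
  open SemiringSum semiring using (sum-cong-≋)
  open CommutativeMonoidSum *-commutativeMonoid using ()
    renaming (sum to product; sum-cong-≋ to product-cong)
  open Identity commutativeSemiring using (identity)
  open SetoidReasoning setoid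

  -- Both sides are homogeneous in `y` and `q`, so a single identity, taken at `w = ⊝ ι q` and
  -- `τ = ι t`, serves every `q` and `t`.
  factorization : ∀ t q y →
    quotientPolynomial (a t) (λ i → p i * q) y ≈ product (λ i → y ⊖ ι ((μ t i + 2) * q))
  factorization t q y = begin
    quotientPolynomial (a t) (λ i → p i * q) y
      ≈⟨ +-cong (product-cong factor) (sum-cong-≋ λ k →
           *-cong (ι-a k) (*-cong (⊝ι* (p k)) (product-cong λ i → factor (punchIn k i)))) ⟩
    _
      ≈⟨ identity ι ι-+ ι-* refl ι-1 y (⊝ ι q) (ι t) ⟩
    product (λ i → y ⊹ (ι (μ-offset i) ⊹ ι (μ-slope i) · ι t ⊹ ι 2) · ⊝ ι q)
      ≈⟨ product-cong (λ i → +-congˡ {y} (trans (⊝ι* (μ t i + 2)) (*-congʳ (ι-μ+2 i)))) ⟨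
    product (λ i → y ⊖ ι ((μ t i + 2) * q)) ∎
    where
    ⊝ι* : ∀ m → ⊝ ι (m * q) ≈ ι m · ⊝ ι q
    ⊝ι* m = trans (-‿cong (ι-* m q)) (-‿distribʳ-* (ι m) (ι q))
    factor : ∀ k → y ⊖ ι (p k * q) ≈ y ⊹ ι (p k) · ⊝ ι q
    factor k = +-congˡ (⊝ι* (p k))
    ι-a : ∀ k → ι (a t k) ≈ ι (a-slope k) · ι t ⊹ ι (a-offset k)
    ι-a k = begin
      ι (a t k)                              ≡⟨ ≡.cong ι (a-linear t k) ⟩
      ι (a-slope k * t + a-offset k)         ≈⟨ ι-+ (a-slope k * t) (a-offset k) ⟩
      ι (a-slope k * t) ⊹ ι (a-offset k)     ≈⟨ +-congʳ (ι-* (a-slope k) t) ⟩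
      ι (a-slope k) · ι t ⊹ ι (a-offset k)       ∎
    ι-μ+2 : ∀ i → ι (μ t i + 2) ≈ ι (μ-offset i) ⊹ ι (μ-slope i) · ι t ⊹ ι 2
    ι-μ+2 i = begin
      ι (μ t i + 2)                                  ≈⟨ ι-+ (μ t i) 2 ⟩
      ι (μ t i) ⊹ ι 2                                ≡⟨ ≡.cong (λ m → ι m ⊹ ι 2) (μ-linear t i) ⟩
      ι (μ-offset i + μ-slope i * t) ⊹ ι 2           ≈⟨ +-congʳ (ι-+ (μ-offset i) (μ-slope i * t)) ⟩
      ι (μ-offset i) ⊹ ι (μ-slope i * t) ⊹ ι 2       ≈⟨ +-congʳ (+-congˡ (ι-* (μ-slope i) t)) ⟩
      ι (μ-offset i) ⊹ ι (μ-slope i) · ι t ⊹ ι 2      ∎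

p>0 : ∀ k → 0 < p k
p>0 = from-yes (Fin.all? λ k → 0 ℕ.<? p k)

-- Guarantees a second part, and with it the common neighbours needed for distance 2.
2≤a₀ : ∀ t → 2 ≤ a t zero
2≤a₀ t = ℕ.≤-trans (from-yes (2 ℕ.≤? 3282)) (ℕ.m≤n+m 3282 (4671576 * t))

distanceIntegral : ∀ c ℓ₁ ℓ₂ t q → q > 0 →
  DistanceIntegral c ℓ₁ ℓ₂ K[ a t · (λ i → p i * q) ]
distanceIntegral c ℓ₁ ℓ₂ t q q>0 = D , isDistanceMatrix , λ F char0 →
  Spectrum.eigenvalue-integer F char0 (a t) (λ i → p i * q) (λ i → (μ t i + 2) * q)
    (factorization F char0 t q) D D-entry
  where
  open Distance (parts (a t) (λ i → p i * q)) (other-part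
    (parts-positive (a t) _ λ i → ℕ.*-mono-< (p>0 i) q>0)
    (ℕ.≤-trans (2≤a₀ t) (first≤length-parts (a t) (λ i → p i * q))))

-- Arithmetic relations between the parameters.

p-2<μ : ∀ t k → + p k ℤ.- + 2 ℤ.< + μ t k
p-2<μ t k = ℤ.<-≤-trans
  -- `μ t k` is least at `t = 0`, where the inequality is a finite check.
  (from-yes (Fin.all? λ k → + p k ℤ.- + 2 ℤ.<? + μ-offset k) k)
  (ℤ.+≤+ (≡.subst (μ-offset k ≤_) (≡.sym (μ-linear t k)) (ℕ.m≤m+n (μ-offset k) _)))

μ<p-2 : ∀ t (k : Fin 4) → + μ t (inject₁ k) ℤ.< + p (suc k) ℤ.- + 2
μ<p-2 t zero                   = from-yes (+ 1 ℤ.<? + 2)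
μ<p-2 t (suc zero)             = from-yes (+ 5 ℤ.<? + 6)
μ<p-2 t (suc (suc zero))       = from-yes (+ 14 ℤ.<? + 16)
μ<p-2 t (suc (suc (suc zero))) = from-yes (+ 20 ℤ.<? + 29)

∑-linear : ∀ {s} (A B p : Vector ℕ s) t →
  (∑ℕ λ k → (A k * t + B k) * p k) ≡ (∑ℕ λ k → A k * p k) * t + (∑ℕ λ k → B k * p k)
∑-linear A B p t = begin
  (∑ℕ λ k → (A k * t + B k) * p k)
    ≡⟨ sum-cong-≗ (λ k → ≡.trans (ℕ.*-distribʳ-+ (p k) (A k * t) (B k))
         (≡.cong (_+ B k * p k) (swap (A k) (p k)))) ⟩
  (∑ℕ λ k → A k * p k * t + B k * p k)
    ≡⟨ ∑-distrib-+ (λ k → A k * p k * t) (λ k → B k * p k) ⟩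
  (∑ℕ λ k → A k * p k * t) + (∑ℕ λ k → B k * p k)
    ≡⟨ ≡.cong (_+ (∑ℕ λ k → B k * p k)) (*-distribʳ-sum t (λ k → A k * p k)) ⟨
  (∑ℕ λ k → A k * p k) * t + (∑ℕ λ k → B k * p k) ∎
  where
  open ≡.≡-Reasoning
  open SemiringSum ℕ.+-*-semiring using (sum-cong-≗; ∑-distrib-+; *-distribʳ-sum)
  swap : ∀ A p → A * t * p ≡ A * p * t
  swap A p = ≡.trans (ℕ.*-assoc A t p)
    (≡.trans (≡.cong (A *_) (ℕ.*-comm t p)) (≡.sym (ℕ.*-assoc A p t)))

n-linear : ∀ t → n t ≡ 13236132 * t + 9286
n-linear t = ≡.trans
  (MonoidSum.sum-cong-≗ ℕ.+-0-monoid λ k → ≡.cong (_* p k) (a-linear t k))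
  (∑-linear a-slope a-offset p t)

-- Both sides are linear in `t`, because only the last factor of the numerator contains it; the
-- hypotheses compare the two coefficients. The final `+ 1` is the empty product ending `∏ℤ`.
numerator-linear : ∀ A B A′ B′ t d e f₀ f₁ f₂ f₃ →
  + A ℤ.* d ≡ f₀ ℤ.* (f₁ ℤ.* (f₂ ℤ.* f₃)) ℤ.* + A′ →
  + B ℤ.* d ≡ f₀ ℤ.* (f₁ ℤ.* (f₂ ℤ.* f₃)) ℤ.* (+ B′ ℤ.- e ℤ.+ + 2) →
  + (A * t + B) ℤ.* d ≡
  f₀ ℤ.* (f₁ ℤ.* (f₂ ℤ.* (f₃ ℤ.* ((+ (B′ + A′ * t) ℤ.- e ℤ.+ + 2) ℤ.* + 1))))
numerator-linear A B A′ B′ t d e f₀ f₁ f₂ f₃ slopes offsets = begin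
  + (A * t + B) ℤ.* d
    ≡⟨ ≡.cong (λ z → (z ℤ.+ + B) ℤ.* d) (ℤ.pos-* A t) ⟩
  (+ A ℤ.* + t ℤ.+ + B) ℤ.* d
    ≡⟨ solve 4 (λ A t B d → (A :* t :+ B) :* d := A :* d :* t :+ B :* d) ≡.refl (+ A) (+ t) (+ B) d ⟩
  + A ℤ.* d ℤ.* + t ℤ.+ + B ℤ.* d
    ≡⟨ ≡.cong₂ (λ x y → x ℤ.* + t ℤ.+ y) slopes offsets ⟩
  f₀ ℤ.* (f₁ ℤ.* (f₂ ℤ.* f₃)) ℤ.* + A′ ℤ.* + t ℤ.+
    f₀ ℤ.* (f₁ ℤ.* (f₂ ℤ.* f₃)) ℤ.* (+ B′ ℤ.- e ℤ.+ + 2)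
    ≡⟨ solve 8 (λ f₀ f₁ f₂ f₃ A′ t B′ e →
         f₀ :* (f₁ :* (f₂ :* f₃)) :* A′ :* t :+ f₀ :* (f₁ :* (f₂ :* f₃)) :* (B′ :- e :+ con (+ 2))
         := f₀ :* (f₁ :* (f₂ :* (f₃ :* ((B′ :+ A′ :* t :- e :+ con (+ 2)) :* con (+ 1))))))
         ≡.refl f₀ f₁ f₂ f₃ (+ A′) (+ t) (+ B′) e ⟩
  f₀ ℤ.* (f₁ ℤ.* (f₂ ℤ.* (f₃ ℤ.* ((+ B′ ℤ.+ + A′ ℤ.* + t ℤ.- e ℤ.+ + 2) ℤ.* + 1))))
    ≡⟨ ≡.cong (λ z → f₀ ℤ.* (f₁ ℤ.* (f₂ ℤ.* (f₃ ℤ.* ((+ B′ ℤ.+ z ℤ.- e ℤ.+ + 2) ℤ.* + 1))))) (ℤ.pos-* A′ t) ⟨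
  f₀ ℤ.* (f₁ ℤ.* (f₂ ℤ.* (f₃ ℤ.* ((+ (B′ + A′ * t) ℤ.- e ℤ.+ + 2) ℤ.* + 1)))) ∎
  where
  open ≡.≡-Reasoning
  open +-*-Solver

denominator≢0 : ∀ k → denominator k ≢ 0ℤ
denominator≢0 = from-yes (Fin.all? λ k → ¬? (denominator k ℤ.≟ 0ℤ))

-- The quotient formula for `a t k` with the denominator cleared; `denominator≢0` makes the two
-- forms equivalent.
a-formula : ∀ t k → + a t k ℤ.* denominator k ≡ numerator t k
a-formula t k = ≡.subst (λ m → + m ℤ.* denominator k ≡ numerator t k)
  (≡.sym (a-linear t k)) (numerator-linear (a-slope k) (a-offset k) _ _ t (denominator k) (+ p k)
    (f k zero) (f k (suc zero)) (f k (suc (suc zero))) (f k (suc (suc (suc zero))))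
    (slopes k) (offsets k))
  where
  -- Only μ₅ depends on t, so t = 0 gives the first four factors.
  f : Fin 5 → Fin 5 → ℤ
  f k i = + μ 0 i ℤ.- + p k ℤ.+ + 2
  c : Fin 5 → ℤ
  c k = f k zero ℤ.* (f k (suc zero) ℤ.* (f k (suc (suc zero)) ℤ.* f k (suc (suc (suc zero)))))
  slopes : ∀ k → + a-slope k ℤ.* denominator k ≡ c k ℤ.* + 13236132
  slopes = from-yes (Fin.all? λ k → + a-slope k ℤ.* denominator k ℤ.≟ c k ℤ.* + 13236132)
  offsets : ∀ k → + a-offset k ℤ.* denominator k ≡ c k ℤ.* (+ 9298 ℤ.- + p k ℤ.+ + 2)
  offsets = from-yes (Fin.all? λ k → + a-offset k ℤ.* denominator k ℤ.≟ c k ℤ.* (+ 9298 ℤ.- + p k ℤ.+ + 2))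

theorem7 : (c ℓ₁ ℓ₂ : Level) (t : ℕ) →
    n t ≡ 13236132 * t + 9286 ×
    (∀ (k : Fin 5) → + p k ℤ.- + 2 ℤ.< + μ t k) ×
    (∀ (k : Fin 4) → + μ t (inject₁ k) ℤ.< + p (suc k) ℤ.- + 2) ×
    (∀ (k : Fin 5) → denominator k ≢ 0ℤ × + a t k ℤ.* denominator k ≡ numerator t k) ×
    (∀ (q : ℕ) → q > 0 →
    Graph.order K[ a t · (λ i → p i * q) ] ≡ q * n t ×
    DistanceIntegral c ℓ₁ ℓ₂ K[ a t · (λ i → p i * q) ])
theorem7 c ℓ₁ ℓ₂ t =
  n-linear t , p-2<μ t , μ<p-2 t , (λ k → denominator≢0 k , a-formula t k) , λ q q>0 →
  order-scaled (a t) p q , distanceIntegral c ℓ₁ ℓ₂ t q q>0
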